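{- For $n\ge 1$ let $D(n)$ be the conjunction of xor-clauses $$D(n)=(x_1\oplus x_{n+1}\oplus y)\wedge\bigwedge_{i=1}^n (x_i\oplus x_{i,a}\oplus x_{i,b})\wedge(x_{i,b}\oplus x_{i,c}\oplus x_{i+1})\wedge(x_i\oplus x_{i,d}\oplus x_{i,e})\wedge(x_{i,e}\oplus x_{i,f}\oplus x_{i+1}),$$ where $y$, $x_i$ ($1\le i\le n+1$) and $x_{i,a},\dots,x_{i,f}$ ($1\le i\le n$) are pairwise distinct variables. Then every EC-simulation formula $\psi$ for $D(n)$ with $\mathrm{vars}(\psi)=\mathrm{vars}(D(n))$ contains at least $2^n$ xor-clauses.
   Context: **Xor-clauses.** An xor-clause is an equation $z_1\oplus\dots\oplus z_k\equiv p$ over distinct propositional variables with $p\in\{\bot,\top\}$ ($\oplus$ is exclusive or); an xor-clause written $z_1\oplus\dots\oplus z_k$ means $z_1\oplus\dots\oplus z_k\equiv\top$. Equations are always simplified to normal form by cancelling repeated variables in pairs. The literal $x$ is identified with $(x\equiv\top)$ and $\neg x$ with $(x\equiv\bot)$. The unsatisfiable empty xor-clause is identified with $\bot$. $\mathrm{vars}(\phi)$ is the set of variables of $\phi$ and $\mathrm{lits}(\phi)=\{x,\neg x\mid x\in\mathrm{vars}(\phi)\}$. **UP.** $C[x/D]$ is the normal form of the xor-clause obtained from $C$ by replacing $x$ by $D$. Rules: from $(x\equiv\top)$ and an xor-clause $C$ infer $C[x/\top]$; from $(x\equiv\bot)$ and $C$ infer $C[x/\bot]$. **EC.** Rules (variables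 in one displayed xor-clause are distinct, $x_1,\dots,x_m$ pairwise distinct, $a,b,c_i,d\in\{\bot,\top\}$): from $(x\equiv\top),(x\equiv\bot)$ infer $\bot$; from $(x\equiv a),(x\oplus y\equiv b)$ infer $(y\equiv a\oplus b)$; from $(x\equiv a),(x\oplus y\oplus z\equiv b)$ infer $(y\oplus z\equiv a\oplus b)$; from $(x_1\oplus x_2\equiv c_1),\dots,(x_{m-1}\oplus x_m\equiv c_{m-1}),(x_1\oplus x_m\oplus y\equiv d)$ infer $(y\equiv c_1\oplus\dots\oplus c_{m-1}\oplus d)$; from $(x_1\oplus x_2\equiv c_1),\dots,(x_{m-1}\oplus x_m\equiv c_{m-1}),(x_m\oplus x_1\equiv c_m)$ with $c_1\oplus\dots\oplus c_m=\top$ infer $\bot$. (In these rules the letters are generic variables.) **Derivability.** For $S\in\{\mathrm{UP},\mathrm{EC}\}$, $D$ is $S$-derivable from $\psi$ if $D$ occurs in a finite sequence of xor-clauses each of which is in $\psi$ or is inferred from earlier ones by a rule of $S$. **EC-simulation formula.** A conjunction $\psi$ of xor-clauses is an EC-simulation formula for $\phi$ if (i) the satisfying truth assignments of $\phi$ are exactly those of $\phi\wedge\psi$ projected to $\mathrm{vars}(\phi)$, and (ii) for all $k\ge 0$, $\tilde l_1,\dots,\tilde l_k\in\mathrm{lits}(\phi)$ and every literal $\hat l$, if $\hat l$ is EC-derivable from $\phi\wedge\tilde l_1\wedge\dots\wedge\tilde l_k$, then $\hat l$ is UP-derivable from $(\phi\wedge\psi)\wedge\tilde l_1\wedge\dots\wedge\tilde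 l_k$. -}

module Defs where

open import Data.Bool using (Bool; true; false; _∧_; _xor_)
import Data.Bool.Properties as Bool
open import Data.Fin using (Fin; zero; suc; inject₁; fromℕ)
open import Data.Fin.Subset using (Subset; ⊥; ⁅_⁆; _∈_; _-_; ⋃)
open import Data.List using (List; []; _∷_; [_]; _++_; map; foldr; concatMap; allFin)
open import Data.List.Membership.Propositional using () renaming (_∈_ to _∈ˡ_)
open import Data.List.Relation.Unary.All using (All)
open import Data.Nat using (ℕ; _+_)
open import Data.Product using (_×_; _,_; ∃-syntax; proj₁; uncurry)
open import Data.Vec using (lookup; zipWith)
import Data.Vec.Functional as F
import Data.Vec.Properties as Vec
open import Function using (Injective; _⇔_)
open import Relation.Binary using (DecidableEquality)
open import Relation.Binary.PropositionalEquality using (_≡_; _≢_; cong₂; cong)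
open import Relation.Nullary.Decidable using (map′; _×-dec_)

private variable
  N : ℕ

-- The propositional variables are the elements of Fin N, for an arbitrary N.
-- An xor-clause z₁ ⊕ ⋯ ⊕ zₖ ≡ p in normal form is the set {z₁,…,zₖ} together
-- with p, so propositional equality identifies clauses up to reordering.
record XorClause (N : ℕ) : Set where
  constructor mkClause
  field
    vars   : Subset N
    parity : Bool

open XorClause public

infix 4 _≟ᶜ_
_≟ᶜ_ : DecidableEquality (XorClause N)
mkClause S p ≟ᶜ mkClause T q =
  map′ (uncurry (cong₂ mkClause)) (λ e → cong vars e , cong parity e)
       (Vec.≡-dec Bool._≟_ S T ×-dec (p Bool.≟ q))

-- zs ≐ p is the normal form of the equation ⨁ zs ≡ p: symmetric difference
-- cancels repeated variables in pairs.
infix 4 _≐_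
_≐_ : List (Fin N) → Bool → XorClause N
zs ≐ p = mkClause (foldr (λ z S → zipWith _xor_ ⁅ z ⁆ S) ⊥ zs) p

⊥ᶜ : XorClause N
⊥ᶜ = [] ≐ true

-- The literals x and ¬x are (x , true) and (x , false).
Literal : ℕ → Set
Literal N = Fin N × Bool

lit : Literal N → XorClause N
lit (x , b) = [ x ] ≐ b

-- A conjunction of xor-clauses; conjunction of formulas is _++_.
Formula : ℕ → Set
Formula N = List (XorClause N)

varsᶠ : Formula N → Subset N
varsᶠ φ = ⋃ (map vars φ)

_∈lits_ : Literal N → Formula N → Set
l ∈lits φ = proj₁ l ∈ varsᶠ φ

Assignment : ℕ → Set
Assignment N = Fin N → Bool

⨁ : ∀ {k} → (Fin k → Bool) → Bool
⨁ = F.foldr _xor_ false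

_⊨ᶜ_ : Assignment N → XorClause N → Set
τ ⊨ᶜ C = ⨁ (λ z → lookup (vars C) z ∧ τ z) ≡ parity C

_⊨_ : Assignment N → Formula N → Set
τ ⊨ φ = All (τ ⊨ᶜ_) φ

-- C [ x / b ] : if x occurs in C it is removed and the constant b is moved to
-- the right-hand side; otherwise C is unchanged.
_[_/_] : XorClause N → Fin N → Bool → XorClause N
C [ x / b ] = mkClause (vars C - x) (parity C xor (lookup (vars C) x ∧ b))

-- A rule system relates a list of available premises to the clauses that can
-- be inferred from them in one step.
RuleSystem : ℕ → Set₁
RuleSystem N = List (XorClause N) → XorClause N → Set

data UP {N : ℕ} (π : List (XorClause N)) : XorClause N → Set where
  unit : ∀ {x b C} →
         ([ x ] ≐ b) ∈ˡ π → C ∈ˡ π →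
         UP π (C [ x / b ])

-- In the last two rules the chain x₁,…,xₘ has m = 2 + k, which the
-- distinctness of x₁ and xₘ forces; c lists c₁,…,cₘ₋₁.
data EC {N : ℕ} (π : List (XorClause N)) : XorClause N → Set where
  conflict   : ∀ {x} →
               ([ x ] ≐ true) ∈ˡ π → ([ x ] ≐ false) ∈ˡ π →
               EC π ⊥ᶜ
  unit₂      : ∀ {x y a b} → x ≢ y →
               ([ x ] ≐ a) ∈ˡ π → (x ∷ y ∷ [] ≐ b) ∈ˡ π →
               EC π ([ y ] ≐ a xor b)
  unit₃      : ∀ {x y z a b} → x ≢ y → x ≢ z → y ≢ z →
               ([ x ] ≐ a) ∈ˡ π → (x ∷ y ∷ z ∷ [] ≐ b) ∈ˡ π →
               EC π (y ∷ z ∷ [] ≐ a xor b)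
  chain      : ∀ {k} (x : Fin (2 + k) → Fin N) (c : Fin (1 + k) → Bool) {y d} →
               Injective _≡_ _≡_ x →
               y ≢ x zero → y ≢ x (fromℕ _) →
               (∀ i → (x (inject₁ i) ∷ x (suc i) ∷ [] ≐ c i) ∈ˡ π) →
               (x zero ∷ x (fromℕ _) ∷ y ∷ [] ≐ d) ∈ˡ π →
               EC π ([ y ] ≐ ⨁ c xor d)
  cycle      : ∀ {k} (x : Fin (2 + k) → Fin N) (c : Fin (1 + k) → Bool) {cₘ} →
               Injective _≡_ _≡_ x →
               (∀ i → (x (inject₁ i) ∷ x (suc i) ∷ [] ≐ c i) ∈ˡ π) →
               (x (fromℕ _) ∷ x zero ∷ [] ≐ cₘ) ∈ˡ π →
               ⨁ c xor cₘ ≡ true →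
               EC π ⊥ᶜ

-- Derivation sequences, most recent clause first.
data Derivation {N : ℕ} (S : RuleSystem N) (φ : Formula N) : List (XorClause N) → Set where
  []    : Derivation S φ []
  given : ∀ {π C} → C ∈ˡ φ → Derivation S φ π → Derivation S φ (C ∷ π)
  infer : ∀ {π C} → S π C → Derivation S φ π → Derivation S φ (C ∷ π)

Derivable : RuleSystem N → Formula N → XorClause N → Set
Derivable S φ D = ∃[ π ] Derivation S φ π × D ∈ˡ π

record ECSimulation {N : ℕ} (φ ψ : Formula N) : Set where
  field
    -- Assignments are total on Fin N, so projecting to vars φ means
    -- considering them up to agreement on vars φ.
    projection : ∀ τ → τ ⊨ φ ⇔
                 (∃[ τ′ ] τ′ ⊨ (φ ++ ψ) × (∀ {z} → z ∈ varsᶠ φ → τ′ z ≡ τ z))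
    simulation : ∀ (ls : List (Literal N)) → All (_∈lits φ) ls → ∀ (l̂ : Literal N) →
                 Derivable EC (φ ++ map lit ls) (lit l̂) →
                 Derivable UP ((φ ++ ψ) ++ map lit ls) (lit l̂)

-- Names of the variables of D(n), with indices shifted to start at 0:
-- x i for xᵢ₊₁ and xa i, …, xf i for xᵢ₊₁,ₐ, …, xᵢ₊₁,f.
data DVar (n : ℕ) : Set where
  y                 : DVar n
  x                 : Fin (ℕ.suc n) → DVar n
  xa xb xc xd xe xf : Fin n → DVar n

D : (n : ℕ) → (DVar n → Fin N) → Formula N
D n ν = clause (x zero) (x (fromℕ n)) y ∷ concatMap block (allFin n)
  where
  clause : DVar n → DVar n → DVar n → XorClause _
  clause u v w = ν u ∷ ν v ∷ ν w ∷ [] ≐ true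

  block : Fin n → Formula _
  block i = clause (x (inject₁ i)) (xa i) (xb i)
          ∷ clause (xb i) (xc i) (x (suc i))
          ∷ clause (x (inject₁ i)) (xd i) (xe i)
          ∷ clause (xe i) (xf i) (x (suc i))
          ∷ []

{-# OPTIONS --safe #-}
module Submission where

-- View D(n) as a graph with vertices xᵢ, xᵢ,b, xᵢ,e whose edges are the clauses,
-- labelled by the remaining variables. Each of the 2ⁿ paths from x₁ to xₙ₊₁ gives
-- an EC-derivation of a literal of y once its labels are set to ⊥. In the
-- simulating UP-derivation the first literal that is not a label of the path is
-- propagated by a clause E of D(n) ∧ ψ with exactly one variable outside the
-- labels. As E is a consequence of D(n), its variables are orthogonal to all
-- homogeneous solutions of D(n), that is, to the coboundaries of vertex sets.
-- Suitable coboundaries show that the variable is y and that E contains xᵢ,a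
-- exactly if the path uses it. So E has no variable xᵢ, hence lies in ψ, and it
-- determines the path.

open import Algebra.Bundles using (module CommutativeRing)
import Algebra.Properties.CommutativeMonoid.Sum as CommutativeMonoidSum
import Algebra.Properties.CommutativeSemigroup as CommutativeSemigroupProperties
open import Data.Bool using (Bool; T; true; false; not; _∧_; _xor_; if_then_else_)
open import Data.Bool.Properties using (xor-∧-commutativeRing; xor-assoc; xor-comm; xor-same; xor-identityʳ; ∧-distribˡ-xor; ∧-distribʳ-xor; ∧-zeroʳ; ∧-identityʳ; ¬-not)
open import Data.Empty using (⊥-elim)
open import Data.Fin using (Fin; zero; suc; toℕ; inject₁; fromℕ; punchIn; punchOut; combine; finToFun; funToFin)
open import Data.Fin.Properties using (_≟_; any?; toℕ-injective; toℕ-inject₁; toℕ-fromℕ; toℕ<n; punchInᵢ≢i; punchIn-injective; punchIn-punchOut; funToFin-finToFin; 2↔Bool; injective⇒≤)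
open import Data.Fin.Subset using (Subset; ⁅_⁆; _∈_; _-_)
open import Data.Fin.Subset.Properties using (x∈⁅x⁆; x≢y⇒x∉⁅y⁆; x∈p∪q⁺; x∈p∪q⁻; ∉⊥; p─⊥≡p)
open import Data.List using (List; []; _∷_; _++_; map; foldr; concatMap; allFin; length; deduplicate)
open import Data.List.Membership.Propositional using (lose) renaming (_∈_ to _∈ˡ_)
open import Data.List.Membership.Propositional.Properties using (∈-allFin; ∈-concatMap⁺; ∈-++⁺ˡ; ∈-++⁺ʳ; ∈-++⁻; ∈-map⁺; ∈-map⁻; ∈-deduplicate⁺)
open import Data.List.Membership.Setoid.Properties using (index-injective)
open import Data.List.Relation.Binary.Subset.Propositional using (_⊆_)
open import Data.List.Relation.Unary.All as All using (All; []; _∷_)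
import Data.List.Relation.Unary.All.Properties as All
open import Data.List.Relation.Unary.Any using (here; there; index)
open import Data.Nat using (ℕ; zero; suc; _≤_; _<_; _+_; _*_; _^_; _≤ᵇ_; _<ᵇ_; s≤s)
open import Data.Nat.Properties using (≤ᵇ⇒≤; <⇒≱; +-suc; +-cancelʳ-≡)
open import Data.Product using (_×_; _,_; ∃; proj₁; proj₂)
open import Data.Sum using (_⊎_; inj₁; inj₂)
open import Data.Vec using (_∷_; lookup; zipWith)
open import Data.Vec.Properties using (lookup-zipWith; lookup-replicate; lookup⇒[]=; []=⇒lookup; zipWith-assoc; zipWith-comm)
open import Function using (Injective; Inverse; Equivalence; _∘_; id; case_of_)
open import Function.Properties.Inverse using (Inverse⇒Injection)
open import Function.Bundles using (module Injection)
open import Relation.Binary.PropositionalEquality using (_≡_; _≢_; refl; sym; trans; cong; cong₂; subst; setoid; module ≡-Reasoning)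
open import Relation.Nullary using (Dec; ¬_; yes; no; contradiction)
open import Relation.Nullary.Decidable using (map′; _⊎-dec_)
open import Defs

open CommutativeMonoidSum (CommutativeRing.+-commutativeMonoid xor-∧-commutativeRing)
  using (sum-remove; sum-replicate-zero) renaming (sum-cong-≗ to ⨁-cong; ∑-distrib-+ to ⨁-xor)
open CommutativeSemigroupProperties (CommutativeRing.+-commutativeSemigroup xor-∧-commutativeRing)
  using () renaming (interchange to xor-interchange)

private variable
  N n m : ℕ

-- Sums modulo 2, comparisons and membership

⨁-false : (f : Fin m → Bool) → (∀ i → f i ≡ false) → ⨁ f ≡ false
⨁-false {m} f f≡false = trans (⨁-cong f≡false) (sum-replicate-zero m)

⨁-single : (f : Fin m → Bool) (u : Fin m) → (∀ i → i ≢ u → f i ≡ false) → ⨁ f ≡ f u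
⨁-single {suc m} f u off = begin
  ⨁ f                         ≡⟨ sum-remove {i = u} f ⟩
  f u xor ⨁ (f ∘ punchIn u)   ≡⟨ cong (f u xor_) (⨁-false _ λ j → off _ (punchInᵢ≢i u j)) ⟩
  f u xor false               ≡⟨ xor-identityʳ (f u) ⟩
  f u                         ∎
  where open ≡-Reasoning

⨁-pair : (f : Fin m → Bool) {u w : Fin m} → u ≢ w →
         (∀ i → i ≢ u → i ≢ w → f i ≡ false) → ⨁ f ≡ f u xor f w
⨁-pair {suc m} f {u} {w} u≢w off = begin
  ⨁ f                                      ≡⟨ sum-remove {i = u} f ⟩
  f u xor ⨁ (f ∘ punchIn u)                ≡⟨ cong (f u xor_) (⨁-single _ (punchOut u≢w) off′) ⟩
  f u xor f (punchIn u (punchOut u≢w))     ≡⟨ cong (λ v → f u xor f v) (punchIn-punchOut u≢w) ⟩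
  f u xor f w                              ∎
  where
  open ≡-Reasoning
  off′ : ∀ j → j ≢ punchOut u≢w → f (punchIn u j) ≡ false
  off′ j j≢ = off _ (punchInᵢ≢i u j) λ eq →
    j≢ (punchIn-injective u j _ (trans eq (sym (punchIn-punchOut u≢w))))

xor≡false⇒≡ : ∀ a b → a xor b ≡ false → a ≡ b
xor≡false⇒≡ false false _ = refl
xor≡false⇒≡ true  true  _ = refl

xor-cancelˡ : ∀ a b → a xor b ≡ a → b ≡ false
xor-cancelˡ false b     eq = eq
xor-cancelˡ true  false eq = refl

≤ᵇ-false : ∀ {a b} → b < a → (a ≤ᵇ b) ≡ false
≤ᵇ-false {a} {b} b<a = ¬-not λ eq → <⇒≱ b<a (≤ᵇ⇒≤ a b (subst T (sym eq) _))

≤ᵇ-xor-<ᵇ-refl : ∀ a → (a ≤ᵇ a) xor (a <ᵇ a) ≡ true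
≤ᵇ-xor-<ᵇ-refl zero          = refl
≤ᵇ-xor-<ᵇ-refl (suc zero)    = refl
≤ᵇ-xor-<ᵇ-refl (suc (suc a)) = ≤ᵇ-xor-<ᵇ-refl (suc a)

-- For fixed `b` the two thresholds differ only at `b`, which lets `cut` single out one diamond. As
-- `suc a ≤ᵇ b` computes to `a <ᵇ b`, the form of `a` must be known before the induction hypothesis
-- matches, whence the separate case for one.
≤ᵇ-xor-<ᵇ-≢ : ∀ a b → a ≢ b → (a ≤ᵇ b) xor (a <ᵇ b) ≡ false
≤ᵇ-xor-<ᵇ-≢ zero          zero    a≢b = contradiction refl a≢b
≤ᵇ-xor-<ᵇ-≢ zero          (suc b) a≢b = refl
≤ᵇ-xor-<ᵇ-≢ (suc a)       zero    a≢b = refl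
≤ᵇ-xor-<ᵇ-≢ (suc zero)    (suc b) a≢b = ≤ᵇ-xor-<ᵇ-≢ zero b (a≢b ∘ cong suc)
≤ᵇ-xor-<ᵇ-≢ (suc (suc a)) (suc b) a≢b = ≤ᵇ-xor-<ᵇ-≢ (suc a) b (a≢b ∘ cong suc)

lookup-⁅⁆-≡ : (u : Fin N) → lookup ⁅ u ⁆ u ≡ true
lookup-⁅⁆-≡ u = []=⇒lookup (x∈⁅x⁆ u)

lookup-⁅⁆-≢ : {u w : Fin N} → w ≢ u → lookup ⁅ u ⁆ w ≡ false
lookup-⁅⁆-≢ w≢u = ¬-not λ eq → x≢y⇒x∉⁅y⁆ w≢u (lookup⇒[]= _ _ eq)

lookup-- : ∀ (S : Subset N) {u w} → w ≢ u → lookup (S - u) w ≡ lookup S w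
lookup-- (b ∷ S) {zero}  {zero}  w≢u = contradiction refl w≢u
lookup-- (b ∷ S) {zero}  {suc w} w≢u = cong (λ T → lookup T w) (p─⊥≡p S)
lookup-- (b ∷ S) {suc u} {zero}  w≢u = refl
lookup-- (b ∷ S) {suc u} {suc w} w≢u = lookup-- S (w≢u ∘ cong suc)

module _ {A : Set} (f : Fin n → List A) where

  All-concatMap-allFin : ∀ {P : A → Set} → (∀ i → All P (f i)) → All P (concatMap f (allFin n))
  All-concatMap-allFin p = All.concat⁺ (All.map⁺ (All.tabulate⁺ p))

  ∈-concatMap-allFin : ∀ i {a} → a ∈ˡ f i → a ∈ˡ concatMap f (allFin n)
  ∈-concatMap-allFin i a∈ = ∈-concatMap⁺ f (lose (∈-allFin i) a∈)

-- Clauses and their variables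

occ : XorClause N → Fin N → Bool
occ C z = lookup (vars C) z

occ-∷ : ∀ (u : Fin N) us p w → occ (u ∷ us ≐ p) w ≡ lookup ⁅ u ⁆ w xor occ (us ≐ p) w
occ-∷ u us p w = lookup-zipWith _xor_ w ⁅ u ⁆ (vars (us ≐ p))

occ-∷-≢ : ∀ {u : Fin N} us p {w} → w ≢ u → occ (u ∷ us ≐ p) w ≡ occ (us ≐ p) w
occ-∷-≢ {u = u} us p {w} w≢u = trans (occ-∷ u us p w) (cong (_xor occ (us ≐ p) w) (lookup-⁅⁆-≢ w≢u))

occ⇒∈ : ∀ (us : List (Fin N)) p {w} → occ (us ≐ p) w ≡ true → w ∈ˡ us
occ⇒∈ []       p {w} eq = contradiction (trans (sym eq) (lookup-replicate w false)) λ ()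
occ⇒∈ (u ∷ us) p {w} eq with w ≟ u
... | yes w≡u = here w≡u
... | no  w≢u = there (occ⇒∈ us p (trans (sym (occ-∷-≢ us p w≢u)) eq))

∉⇒occ : ∀ (us : List (Fin N)) p {w} → All (w ≢_) us → occ (us ≐ p) w ≡ false
∉⇒occ us p w∉us = ¬-not λ eq → All.lookup w∉us (occ⇒∈ us p eq) refl

occ-head : ∀ {u : Fin N} us p → All (u ≢_) us → occ (u ∷ us ≐ p) u ≡ true
occ-head {u = u} us p u∉us =
  trans (occ-∷ u us p u) (cong₂ _xor_ (lookup-⁅⁆-≡ u) (∉⇒occ us p u∉us))

-- The rule `unit₃` eliminates the first variable listed, whereas the edges of a path carry their
-- label second.
≐-swap : ∀ (u v : Fin N) us p → (u ∷ v ∷ us ≐ p) ≡ (v ∷ u ∷ us ≐ p)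
≐-swap u v us p = cong (λ S → mkClause S p) (begin
  ⁅ u ⁆ ⊕ (⁅ v ⁆ ⊕ S)   ≡⟨ zipWith-assoc xor-assoc ⁅ u ⁆ ⁅ v ⁆ S ⟨
  (⁅ u ⁆ ⊕ ⁅ v ⁆) ⊕ S   ≡⟨ cong (_⊕ S) (zipWith-comm xor-comm ⁅ u ⁆ ⁅ v ⁆) ⟩
  (⁅ v ⁆ ⊕ ⁅ u ⁆) ⊕ S   ≡⟨ zipWith-assoc xor-assoc ⁅ v ⁆ ⁅ u ⁆ S ⟩
  ⁅ v ⁆ ⊕ (⁅ u ⁆ ⊕ S)   ∎)
  where
  open ≡-Reasoning
  _⊕_ = zipWith _xor_
  S = vars (us ≐ p)

occ-[/] : ∀ (C : XorClause N) {u b w} → w ≢ u → occ (C [ u / b ]) w ≡ occ C w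
occ-[/] C w≢u = lookup-- (vars C) w≢u

-- By linearity, each `u` adds the indicator of one variable; repeated variables cancel alike on
-- both sides.
⨁-occ : ∀ (τ : Assignment N) us p →
        ⨁ (λ z → occ (us ≐ p) z ∧ τ z) ≡ foldr _xor_ false (map τ us)
⨁-occ τ []       p = ⨁-false _ λ z → cong (_∧ τ z) (lookup-replicate z false)
⨁-occ τ (u ∷ us) p = begin
  ⨁ (λ z → occ (u ∷ us ≐ p) z ∧ τ z)
    ≡⟨ ⨁-cong (λ z → trans (cong (_∧ τ z) (occ-∷ u us p z)) (∧-distribʳ-xor (τ z) (lookup ⁅ u ⁆ z) _)) ⟩
  ⨁ (λ z → (lookup ⁅ u ⁆ z ∧ τ z) xor (occ (us ≐ p) z ∧ τ z))
    ≡⟨ ⨁-xor (λ z → lookup ⁅ u ⁆ z ∧ τ z) _ ⟩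
  ⨁ (λ z → lookup ⁅ u ⁆ z ∧ τ z) xor ⨁ (λ z → occ (us ≐ p) z ∧ τ z)
    ≡⟨ cong₂ _xor_ (⨁-single _ u λ i i≢u → cong (_∧ τ i) (lookup-⁅⁆-≢ i≢u)) (⨁-occ τ us p) ⟩
  (lookup ⁅ u ⁆ u ∧ τ u) xor foldr _xor_ false (map τ us)
    ≡⟨ cong (λ b → (b ∧ τ u) xor _) (lookup-⁅⁆-≡ u) ⟩
  τ u xor foldr _xor_ false (map τ us) ∎
  where open ≡-Reasoning

⊨ᶜ-cong : ∀ {σ τ : Assignment N} C → (∀ {z} → z ∈ vars C → σ z ≡ τ z) → σ ⊨ᶜ C → τ ⊨ᶜ C
⊨ᶜ-cong {σ = σ} {τ} C σ≡τ σ⊨C = trans (⨁-cong agree) σ⊨C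
  where
  agree : ∀ z → occ C z ∧ τ z ≡ occ C z ∧ σ z
  agree z with occ C z in eq
  ... | true  = sym (σ≡τ (lookup⇒[]= z _ eq))
  ... | false = refl

∈varsᶠ⁺ : ∀ {φ : Formula N} {C z} → C ∈ˡ φ → z ∈ vars C → z ∈ varsᶠ φ
∈varsᶠ⁺ (here refl) z∈C = x∈p∪q⁺ (inj₁ z∈C)
∈varsᶠ⁺ (there C∈φ) z∈C = x∈p∪q⁺ (inj₂ (∈varsᶠ⁺ C∈φ z∈C))

∈varsᶠ⁻ : ∀ (φ : Formula N) {z} → z ∈ varsᶠ φ → ∃ λ C → C ∈ˡ φ × z ∈ vars C
∈varsᶠ⁻ []      z∈ = contradiction z∈ ∉⊥
∈varsᶠ⁻ (C ∷ φ) z∈ with x∈p∪q⁻ (vars C) _ z∈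
... | inj₁ z∈C = C , here refl , z∈C
... | inj₂ z∈φ = let E , E∈φ , z∈E = ∈varsᶠ⁻ φ z∈φ in E , there E∈φ , z∈E

-- Derivations

given-all : ∀ {S : RuleSystem N} {φ} π → π ⊆ φ → Derivation S φ π
given-all []      π⊆φ = []
given-all (C ∷ π) π⊆φ = given (π⊆φ (here refl)) (given-all π (π⊆φ ∘ there))

-- Each step uses clauses of `φ` only, so quantifying over all larger `π` lets the steps be stacked
-- on top of each other.
infer-all : ∀ {S : RuleSystem N} {φ cs} →
            All (λ C → ∀ {π} → φ ⊆ π → S π C) cs → Derivation S φ (cs ++ φ)
infer-all []                           = given-all _ id
infer-all {cs = _ ∷ cs} (step ∷ steps) = infer (step (∈-++⁺ʳ cs)) (infer-all steps)

-- Once the variables of `L` are assigned, such a clause propagates its `pivot`.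
record SoleOutside (L : Fin N → Bool) (E : XorClause N) : Set where
  field
    pivot     : Fin N
    pivot-occ : occ E pivot ≡ true
    pivot∉L   : L pivot ≡ false
    others    : ∀ {w} → L w ≡ false → w ≢ pivot → occ E w ≡ false

SameOutside : (L : Fin N → Bool) → XorClause N → XorClause N → Set
SameOutside L C E = ∀ w → L w ≡ false → occ C w ≡ occ E w

-- This turns a derived literal into information on the input clause it stems from: outside `L` that
-- clause has the variable of the literal and no other.
unit-soleOutside : ∀ {L : Fin N → Bool} {E u b} → SameOutside L (lit (u , b)) E →
                   L u ≡ false → SoleOutside L E
unit-soleOutside {u = u} {b} same u∉L = record
  { pivot     = u
  ; pivot-occ = trans (sym (same u u∉L)) (occ-head {u = u} [] b [])
  ; pivot∉L   = u∉L
  ; others    = λ w∉L w≢u → trans (sym (same _ w∉L)) (∉⇒occ (u ∷ []) b (w≢u ∷ []))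
  }

-- Propagating variables of L does not change a clause outside L, so as long as
-- only variables of L are propagated every derived clause agrees outside L with
-- a clause of φ.
UP-invariant : ∀ (L : Fin N → Bool) {φ π} → Derivation UP φ π →
               (∃ λ E → E ∈ˡ φ × SoleOutside L E) ⊎
               All (λ C → ∃ λ E → E ∈ˡ φ × SameOutside L C E) π
UP-invariant L []              = inj₂ []
UP-invariant L (given C∈φ der) with UP-invariant L der
... | inj₁ sole = inj₁ sole
... | inj₂ all  = inj₂ ((_ , C∈φ , λ _ _ → refl) ∷ all)
UP-invariant L (infer (unit {u} {b} {C} u∈π C∈π) der) with UP-invariant L der
... | inj₁ sole = inj₁ sole
... | inj₂ all with L u in eq
...   | false = let E , E∈φ , same = All.lookup all u∈π in
                inj₁ (E , E∈φ , unit-soleOutside {b = b} same eq)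
...   | true  = let E , E∈φ , same = All.lookup all C∈π in
                inj₂ ((E , E∈φ , λ w w∉L → trans (occ-[/] C {b = b} (w≢u w∉L)) (same w w∉L)) ∷ all)
  where
  w≢u : ∀ {w} → L w ≡ false → w ≢ u
  w≢u w∉L refl = contradiction (trans (sym w∉L) eq) λ ()

-- If propagation never leaves `L`, the invariant reaches the derived literal itself, and the input
-- clause matching it is the one sought.
UP-soleOutside : ∀ (L : Fin N → Bool) {φ u b} → L u ≡ false → Derivable UP φ (lit (u , b)) →
                 ∃ λ E → E ∈ˡ φ × SoleOutside L E
UP-soleOutside L {b = b} u∉L (π , der , u∈π) with UP-invariant L der
... | inj₁ sole = sole
... | inj₂ all  = let E , E∈φ , same = All.lookup all u∈π in
                  E , E∈φ , unit-soleOutside {b = b} same u∉L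

lit-¬soleOutside : ∀ {L : Fin N → Bool} {u b} → L u ≡ true → ¬ SoleOutside L (lit (u , b))
lit-¬soleOutside {u = u} {b} u∈L sole with occ⇒∈ (u ∷ []) b (SoleOutside.pivot-occ sole)
... | here refl = contradiction (trans (sym (SoleOutside.pivot∉L sole)) u∈L) λ ()

-- A literal on a variable of `L` has nothing outside `L` that could be the pivot.
drop-literals : ∀ {L : Fin N → Bool} {φ ls} → All (λ l → L (proj₁ l) ≡ true) ls →
                (∃ λ E → E ∈ˡ φ ++ map lit ls × SoleOutside L E) →
                ∃ λ E → E ∈ˡ φ × SoleOutside L E
drop-literals {φ = φ} ls⊆L (E , E∈ , sole) with ∈-++⁻ φ E∈
... | inj₁ E∈φ = E , E∈φ , sole
... | inj₂ E∈ls with ∈-map⁻ lit E∈ls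
...   | (_ , b) , l∈ , refl = ⊥-elim (lit-¬soleOutside {b = b} (All.lookup ls⊆L l∈) sole)

-- The clauses of D(n)

-- The arguments follow the order of the clause: the label stands between its ends, except in
-- `closing`, where the label `y` comes last.
data Edge {n : ℕ} : DVar n → DVar n → DVar n → Set where
  closing : Edge (x zero) (x (fromℕ n)) y
  edgeᵃ   : ∀ i → Edge (x (inject₁ i)) (xa i) (xb i)
  edgeᶜ   : ∀ i → Edge (xb i) (xc i) (x (suc i))
  edgeᵈ   : ∀ i → Edge (x (inject₁ i)) (xd i) (xe i)
  edgeᶠ   : ∀ i → Edge (xe i) (xf i) (x (suc i))

edgeClause : (DVar n → Fin N) → DVar n → DVar n → DVar n → XorClause N
edgeClause ν u v w = map ν (u ∷ v ∷ w ∷ []) ≐ true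

All-D : ∀ (ν : DVar n → Fin N) {P : XorClause N → Set} →
        (∀ {u v w} → Edge u v w → P (edgeClause ν u v w)) → All P (D n ν)
All-D ν p = p closing ∷ All-concatMap-allFin _ λ i →
  p (edgeᵃ i) ∷ p (edgeᶜ i) ∷ p (edgeᵈ i) ∷ p (edgeᶠ i) ∷ []

edge∈D : ∀ (ν : DVar n → Fin N) {u v w} → Edge u v w → edgeClause ν u v w ∈ˡ D n ν
edge∈D ν closing   = here refl
edge∈D ν (edgeᵃ i) = there (∈-concatMap-allFin _ i (here refl))
edge∈D ν (edgeᶜ i) = there (∈-concatMap-allFin _ i (there (here refl)))
edge∈D ν (edgeᵈ i) = there (∈-concatMap-allFin _ i (there (there (here refl))))
edge∈D ν (edgeᶠ i) = there (∈-concatMap-allFin _ i (there (there (there (here refl)))))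

-- The index `suc n` matters: for n = 0 the two ends of `closing` coincide.
edge-distinct : ∀ {u v w : DVar (suc n)} → Edge u v w → v ≢ u × v ≢ w × u ≢ w
edge-distinct closing   = (λ ()) , (λ ()) , (λ ())
edge-distinct (edgeᵃ i) = (λ ()) , (λ ()) , (λ ())
edge-distinct (edgeᶜ i) = (λ ()) , (λ ()) , (λ ())
edge-distinct (edgeᵈ i) = (λ ()) , (λ ()) , (λ ())
edge-distinct (edgeᶠ i) = (λ ()) , (λ ()) , (λ ())

-- Solutions of D(n) and of its homogeneous system

Homogeneous : (DVar n → Bool) → Set
Homogeneous δ = ∀ {u v w} → Edge u v w → δ u xor (δ v xor δ w) ≡ false

-- p, q, r are the values at the vertices xᵢ, xᵢ,b, xᵢ,e; an edge gets the
-- difference of its ends.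
coboundary : (Fin (suc n) → Bool) → (Fin n → Bool) → (Fin n → Bool) → DVar n → Bool
coboundary {n} p q r y = p zero xor p (fromℕ n)
coboundary p q r (x i)  = p i
coboundary p q r (xa i) = p (inject₁ i) xor q i
coboundary p q r (xb i) = q i
coboundary p q r (xc i) = q i xor p (suc i)
coboundary p q r (xd i) = p (inject₁ i) xor r i
coboundary p q r (xe i) = r i
coboundary p q r (xf i) = r i xor p (suc i)

-- A label has the sum of the values at its two ends, so every end value occurs twice in a clause.
-- The two helpers differ in where the label stands.
coboundary-homogeneous : ∀ (p : Fin (suc n) → Bool) q r → Homogeneous (coboundary p q r)
coboundary-homogeneous p q r = λ where
    closing   → outer (p zero) (p (fromℕ _))
    (edgeᵃ i) → middle (p (inject₁ i)) (q i)
    (edgeᶜ i) → middle (q i) (p (suc i))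
    (edgeᵈ i) → middle (p (inject₁ i)) (r i)
    (edgeᶠ i) → middle (r i) (p (suc i))
  where
  outer : ∀ a b → a xor (b xor (a xor b)) ≡ false
  outer a b = trans (sym (xor-assoc a b (a xor b))) (xor-same (a xor b))
  middle : ∀ a b → a xor ((a xor b) xor b) ≡ false
  middle a b = trans (cong (a xor_) (xor-comm (a xor b) b)) (outer a b)

-- A particular solution of D(n), because each clause contains exactly one label.
base : DVar n → Bool
base (x i)  = false
base (xb i) = false
base (xe i) = false
base _      = true

base-edge : ∀ {u v w : DVar n} → Edge u v w → base u xor (base v xor base w) ≡ true
base-edge closing   = refl
base-edge (edgeᵃ i) = refl
base-edge (edgeᶜ i) = refl
base-edge (edgeᵈ i) = refl
base-edge (edgeᶠ i) = refl

-- Consequences of D(n)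

module Embedded (ν : DVar n → Fin N) (ν-injective : Injective _≡_ _≡_ ν) where

  preimage? : ∀ z → Dec (∃ λ v → ν v ≡ z)
  preimage? z = map′ to from
    ( (ν y ≟ z) ⊎-dec any? (λ i → ν (x i) ≟ z)
      ⊎-dec any? (λ i → ν (xa i) ≟ z) ⊎-dec any? (λ i → ν (xb i) ≟ z)
      ⊎-dec any? (λ i → ν (xc i) ≟ z) ⊎-dec any? (λ i → ν (xd i) ≟ z)
      ⊎-dec any? (λ i → ν (xe i) ≟ z) ⊎-dec any? (λ i → ν (xf i) ≟ z))
    where
    to : _ → ∃ λ v → ν v ≡ z
    to (inj₁ eq) = y , eq
    to (inj₂ (inj₁ (i , eq))) = x i , eq
    to (inj₂ (inj₂ (inj₁ (i , eq)))) = xa i , eq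
    to (inj₂ (inj₂ (inj₂ (inj₁ (i , eq))))) = xb i , eq
    to (inj₂ (inj₂ (inj₂ (inj₂ (inj₁ (i , eq)))))) = xc i , eq
    to (inj₂ (inj₂ (inj₂ (inj₂ (inj₂ (inj₁ (i , eq))))))) = xd i , eq
    to (inj₂ (inj₂ (inj₂ (inj₂ (inj₂ (inj₂ (inj₁ (i , eq)))))))) = xe i , eq
    to (inj₂ (inj₂ (inj₂ (inj₂ (inj₂ (inj₂ (inj₂ (i , eq)))))))) = xf i , eq
    from : (∃ λ v → ν v ≡ z) → _
    from (y , eq) = inj₁ eq
    from (x i , eq) = inj₂ (inj₁ (i , eq))
    from (xa i , eq) = inj₂ (inj₂ (inj₁ (i , eq)))
    from (xb i , eq) = inj₂ (inj₂ (inj₂ (inj₁ (i , eq))))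
    from (xc i , eq) = inj₂ (inj₂ (inj₂ (inj₂ (inj₁ (i , eq)))))
    from (xd i , eq) = inj₂ (inj₂ (inj₂ (inj₂ (inj₂ (inj₁ (i , eq))))))
    from (xe i , eq) = inj₂ (inj₂ (inj₂ (inj₂ (inj₂ (inj₂ (inj₁ (i , eq)))))))
    from (xf i , eq) = inj₂ (inj₂ (inj₂ (inj₂ (inj₂ (inj₂ (inj₂ (i , eq)))))))

  ext : (DVar n → Bool) → Assignment N
  ext h z with preimage? z
  ... | yes (v , _) = h v
  -- The value false off the image of `ν` keeps `ext` additive and makes `ext (labels s)` a subset
  -- of the image.
  ... | no  _       = false

  ext-ν : ∀ h v → ext h (ν v) ≡ h v
  ext-ν h v with preimage? (ν v)
  ... | yes (u , eq) = cong h (ν-injective eq)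
  ... | no  ∄        = contradiction (v , refl) ∄

  ext-xor : ∀ g h z → ext (λ v → g v xor h v) z ≡ ext g z xor ext h z
  ext-xor g h z with preimage? z
  ... | yes _ = refl
  ... | no  _ = refl

  ext-true : ∀ h {z} → ext h z ≡ true → ∃ λ v → ν v ≡ z × h v ≡ true
  ext-true h {z} eq with preimage? z
  ... | yes (v , νv≡z) = v , νv≡z , eq

  ext⊨D : ∀ h → (∀ {u v w} → Edge u v w → h u xor (h v xor h w) ≡ true) → ext h ⊨ D n ν
  ext⊨D h solves = All-D ν λ {u} {v} {w} e → begin
    ⨁ (λ z → occ (edgeClause ν u v w) z ∧ ext h z)
      ≡⟨ ⨁-occ (ext h) (map ν (u ∷ v ∷ w ∷ [])) true ⟩
    ext h (ν u) xor (ext h (ν v) xor (ext h (ν w) xor false))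
      ≡⟨ cong (λ b → ext h (ν u) xor (ext h (ν v) xor b)) (xor-identityʳ _) ⟩
    ext h (ν u) xor (ext h (ν v) xor ext h (ν w))
      ≡⟨ cong₂ _xor_ (ext-ν h u) (cong₂ _xor_ (ext-ν h v) (ext-ν h w)) ⟩
    h u xor (h v xor h w)
      ≡⟨ solves e ⟩
    true ∎
    where open ≡-Reasoning

  Entailed : XorClause N → Set
  Entailed E = ∀ τ → τ ⊨ D n ν → τ ⊨ᶜ E

  -- Both `base` and `base` plus `δ` solve D(n), hence satisfy `E`; subtracting the two equations
  -- cancels the parity.
  Entailed⇒orthogonal : ∀ {E δ} → Entailed E → Homogeneous δ →
                        ⨁ (λ z → occ E z ∧ ext δ z) ≡ false
  Entailed⇒orthogonal {E} {δ} entailed hom = xor-cancelˡ (parity E) _ (begin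
    parity E xor ⨁ (λ z → occ E z ∧ ext δ z)
      ≡⟨ cong (_xor ⨁ (λ z → occ E z ∧ ext δ z)) (entailed (ext base) (ext⊨D base base-edge)) ⟨
    ⨁ (λ z → occ E z ∧ ext base z) xor ⨁ (λ z → occ E z ∧ ext δ z)
      ≡⟨ ⨁-xor (λ z → occ E z ∧ ext base z) _ ⟨
    ⨁ (λ z → (occ E z ∧ ext base z) xor (occ E z ∧ ext δ z))
      ≡⟨ ⨁-cong (λ z → trans (cong (occ E z ∧_) (ext-xor base δ z)) (∧-distribˡ-xor (occ E z) _ _)) ⟨
    ⨁ (λ z → occ E z ∧ ext base+δ z)
      ≡⟨ entailed (ext base+δ) (ext⊨D base+δ solves) ⟩
    parity E ∎)
    where
    open ≡-Reasoning
    base+δ : DVar n → Bool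
    base+δ v = base v xor δ v
    solves : ∀ {u v w} → Edge u v w → base+δ u xor (base+δ v xor base+δ w) ≡ true
    solves {u} {v} {w} e = trans
      (trans (cong (base+δ u xor_) (xor-interchange (base v) _ _ _)) (xor-interchange (base u) _ _ _))
      (cong₂ _xor_ (base-edge e) (hom e))

  InImage : XorClause N → Set
  InImage E = ∀ {z} → occ E z ≡ true → ∃ λ v → ν v ≡ z

  D-InImage : All InImage (D n ν)
  D-InImage = All-D ν λ {u} {v} {w} _ eq →
    let t , _ , z≡νt = ∈-map⁻ ν (occ⇒∈ (map ν (u ∷ v ∷ w ∷ [])) true eq) in t , sym z≡νt

  -- The labels of the path which in the i-th diamond goes through xᵢ,b if s i,
  -- and through xᵢ,e otherwise.
  labels : (Fin n → Bool) → DVar n → Bool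
  labels s (xa i) = s i
  labels s (xc i) = s i
  labels s (xd i) = not (s i)
  labels s (xf i) = not (s i)
  labels s _      = false

  -- A consequence of D(n) with one variable outside the labels of a path

  module _ (s : Fin n → Bool) {E : XorClause N} (entailed : Entailed E)
           (sole : SoleOutside (ext (labels s)) E) where
    open SoleOutside sole

    -- Off the path labels, `E` has no variable but the pivot; on them, `δ` vanishes. The hypothesis
    -- concerns a single `w` so that `occ-on-path` can exempt xᵢ,a.
    off-pivot : ∀ {δ w} → (∀ v → ν v ≡ w → labels s v ≡ true → δ v ≡ false) →
                w ≢ pivot → occ E w ∧ ext δ w ≡ false
    off-pivot {δ} {w} vanish w≢pivot with ext (labels s) w in eq
    ... | false = cong (_∧ ext δ w) (others eq w≢pivot)
    ... | true  = let v , νv≡w , v∈L = ext-true (labels s) eq in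
      trans (cong (occ E w ∧_) (trans (cong (ext δ) (sym νv≡w)) (trans (ext-ν δ v) (vanish v νv≡w v∈L))))
            (∧-zeroʳ (occ E w))

    -- Only the term at the pivot survives in the orthogonality relation between `E` and `δ`.
    pivot-vanish : ∀ {δ v} → Homogeneous δ → (∀ u → labels s u ≡ true → δ u ≡ false) →
                   ν v ≡ pivot → δ v ≡ false
    pivot-vanish {δ} {v} hom vanish νv≡pivot = begin
      δ v                              ≡⟨ ext-ν δ v ⟨
      ext δ (ν v)                      ≡⟨ cong (ext δ) νv≡pivot ⟩
      ext δ pivot                      ≡⟨ cong (_∧ ext δ pivot) pivot-occ ⟨
      occ E pivot ∧ ext δ pivot        ≡⟨ ⨁-single _ pivot (λ w → off-pivot {δ} λ u _ → vanish u) ⟨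
      ⨁ (λ z → occ E z ∧ ext δ z)      ≡⟨ Entailed⇒orthogonal {E} entailed hom ⟩
      false                            ∎
      where open ≡-Reasoning

    -- ones excludes that pivot is a vertex, avoided that it is a label off the path.
    ones avoided : DVar n → Bool
    ones    = coboundary (λ _ → true) (λ _ → true) (λ _ → true)
    avoided = coboundary (λ _ → false) (not ∘ s) s

    ones-vanish : ∀ u → labels s u ≡ true → ones u ≡ false
    ones-vanish (xa i) _ = refl
    ones-vanish (xc i) _ = refl
    ones-vanish (xd i) _ = refl
    ones-vanish (xf i) _ = refl

    avoided-vanish : ∀ u → labels s u ≡ true → avoided u ≡ false
    avoided-vanish (xa i) eq = cong not eq
    avoided-vanish (xc i) eq = trans (xor-identityʳ _) (cong not eq)
    avoided-vanish (xd i) eq with false ← s i = refl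
    avoided-vanish (xf i) eq with false ← s i = refl

    pivot≡y : InImage E → ν y ≡ pivot
    pivot≡y inImage with inImage pivot-occ
    ... | v , νv≡pivot = subst (λ u → ν u ≡ pivot)
      (only-y v v∉L
        (pivot-vanish (coboundary-homogeneous _ _ _) ones-vanish νv≡pivot)
        (pivot-vanish (coboundary-homogeneous _ _ _) avoided-vanish νv≡pivot))
      νv≡pivot
      where
      v∉L : labels s v ≡ false
      v∉L = trans (sym (ext-ν (labels s) v)) (trans (cong (ext (labels s)) νv≡pivot) pivot∉L)
      -- The constructors without a clause are the vertices, where `ones` is true.
      only-y : ∀ v → labels s v ≡ false → ones v ≡ false → avoided v ≡ false → v ≡ y
      only-y y      _ _ _ = refl
      only-y (xa i) l _ a with s i
      only-y (xa i) () _ _ | true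
      only-y (xa i) _ _ () | false
      only-y (xc i) l _ a with s i
      only-y (xc i) () _ _ | true
      only-y (xc i) _ _ () | false
      only-y (xd i) l _ a with s i
      only-y (xd i) () _ _ | false
      only-y (xd i) _ _ () | true
      only-y (xf i) l _ a with s i
      only-y (xf i) () _ _ | false
      only-y (xf i) _ _ () | true

    module _ (νy≡pivot : ν y ≡ pivot) where

      occ-outside : ∀ {v} → labels s v ≡ false → v ≢ y → occ E (ν v) ≡ false
      occ-outside {v} v∉L v≢y = others (trans (ext-ν (labels s) v) v∉L)
        λ νv≡pivot → v≢y (ν-injective (trans νv≡pivot (sym νy≡pivot)))

      -- The coboundary of an initial segment of the path meets the path and
      -- the closing edge in y and xᵢ,a only.
      cut : Fin n → DVar n → Bool
      cut i = coboundary (λ j → toℕ j ≤ᵇ toℕ i) (λ j → toℕ j <ᵇ toℕ i) (λ j → toℕ j <ᵇ toℕ i)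

      -- The segment contains x₁ but not xₙ₊₁, so the closing edge leaves it.
      cut-y : ∀ i → cut i y ≡ true
      cut-y i = cong not (≤ᵇ-false (subst (toℕ i <_) (sym (toℕ-fromℕ n)) (toℕ<n i)))

      cut-xa : ∀ i → cut i (xa i) ≡ true
      cut-xa i rewrite toℕ-inject₁ i = ≤ᵇ-xor-<ᵇ-refl (toℕ i)

      -- Besides the closing edge, only the edges labelled xᵢ,a and xᵢ,d leave the segment, and xᵢ,d
      -- is off the path when `s i` is true.
      cut-vanish : ∀ {i} → s i ≡ true → ∀ u → u ≢ xa i → labels s u ≡ true → cut i u ≡ false
      cut-vanish {i} si (xa j) u≢ _ rewrite toℕ-inject₁ j =
        ≤ᵇ-xor-<ᵇ-≢ (toℕ j) (toℕ i) λ eq → u≢ (cong xa (toℕ-injective eq))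
      -- Both ends of the edge have the same value, as `suc (toℕ j) ≤ᵇ toℕ i` computes to
      -- `toℕ j <ᵇ toℕ i`.
      cut-vanish {i} si (xc j) _ _ = xor-same (toℕ j <ᵇ toℕ i)
      cut-vanish {i} si (xd j) _ lj rewrite toℕ-inject₁ j =
        ≤ᵇ-xor-<ᵇ-≢ (toℕ j) (toℕ i) λ eq →
          contradiction (trans (sym lj) (cong not (trans (cong s (toℕ-injective eq)) si))) λ ()
      cut-vanish {i} si (xf j) _ _ = xor-same (toℕ j <ᵇ toℕ i)

      -- Orthogonality to `cut i` leaves two terms, at the pivot y and at xᵢ,a. They are equal, and
      -- the one at y is true.
      occ-on-path : ∀ i → s i ≡ true → occ E (ν (xa i)) ≡ true
      occ-on-path i si = begin
        occ E ℓ                                             ≡⟨ ∧-identityʳ _ ⟨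
        occ E ℓ ∧ true                                      ≡⟨ cong (occ E ℓ ∧_) (trans (ext-ν (cut i) (xa i)) (cut-xa i)) ⟨
        occ E ℓ ∧ ext (cut i) ℓ                             ≡⟨ xor≡false⇒≡ _ _ pair-cancels ⟨
        occ E pivot ∧ ext (cut i) pivot                     ≡⟨ cong (_∧ ext (cut i) pivot) pivot-occ ⟩
        ext (cut i) pivot                                   ≡⟨ cong (ext (cut i)) νy≡pivot ⟨
        ext (cut i) (ν y)                                   ≡⟨ trans (ext-ν (cut i) y) (cut-y i) ⟩
        true                                                ∎
        where
        open ≡-Reasoning
        ℓ = ν (xa i)
        pivot≢ℓ : pivot ≢ ℓ
        pivot≢ℓ eq = case ν-injective (trans νy≡pivot eq) of λ ()
        pair-cancels : (occ E pivot ∧ ext (cut i) pivot) xor (occ E ℓ ∧ ext (cut i) ℓ) ≡ false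
        pair-cancels = trans
          (sym (⨁-pair (λ z → occ E z ∧ ext (cut i) z) pivot≢ℓ λ w w≢pivot w≢ℓ →
            off-pivot {cut i} (λ v νv≡w → cut-vanish si v λ { refl → w≢ℓ (sym νv≡w) }) w≢pivot))
          (Entailed⇒orthogonal {E} entailed (coboundary-homogeneous _ _ _))

      occ-xa : ∀ i → occ E (ν (xa i)) ≡ s i
      occ-xa i with s i in eq
      ... | true  = occ-on-path i eq
      ... | false = occ-outside eq λ ()

-- The chain x₁, …, xₙ₊₁ of equivalences

-- The length is written with `n * 2` because `suc n * 2` computes to `2 + n * 2`, matching the
-- recursion by two entries.
interleave : ∀ {A : Set} n → (Fin (suc n) → A) → (Fin n → A) → Fin (suc (n * 2)) → A
interleave n       f g zero          = f zero
interleave (suc n) f g (suc zero)    = g zero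
interleave (suc n) f g (suc (suc j)) = interleave n (f ∘ suc) (g ∘ suc) j

interleave-last : ∀ {A : Set} n (f : Fin (suc n) → A) g →
                  interleave n f g (fromℕ (n * 2)) ≡ f (fromℕ n)
interleave-last zero    f g = refl
interleave-last (suc n) f g = interleave-last n (f ∘ suc) (g ∘ suc)

interleave-step : ∀ {A : Set} (R : A → A → Set) n (f : Fin (suc n) → A) g →
                  (∀ i → R (f (inject₁ i)) (g i)) → (∀ i → R (g i) (f (suc i))) →
                  ∀ j → R (interleave n f g (inject₁ j)) (interleave n f g (suc j))
interleave-step R (suc n) f g fg gf zero          = fg zero
interleave-step R (suc n) f g fg gf (suc zero)    = gf zero
interleave-step R (suc n) f g fg gf (suc (suc j)) =
  interleave-step R n (f ∘ suc) (g ∘ suc) (fg ∘ suc) (gf ∘ suc) j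

-- The offset `k` is there for the induction: dropping two entries raises it by 2.
interleave-position : ∀ {A : Set} (pos : A → ℕ) k n (f : Fin (suc n) → A) g →
                      (∀ i → pos (f i) ≡ toℕ i * 2 + k) →
                      (∀ i → pos (g i) ≡ suc (toℕ i * 2 + k)) →
                      ∀ j → pos (interleave n f g j) ≡ toℕ j + k
interleave-position pos k n       f g pf pg zero          = pf zero
interleave-position pos k (suc n) f g pf pg (suc zero)    = pg zero
interleave-position pos k (suc n) f g pf pg (suc (suc j)) = trans
  (interleave-position pos (2 + k) n (f ∘ suc) (g ∘ suc)
    (λ i → trans (pf (suc i)) (shift (toℕ i * 2)))
    (λ i → trans (pg (suc i)) (cong suc (shift (toℕ i * 2)))) j)
  (sym (shift (toℕ j)))
  where
  shift : ∀ a → 2 + (a + k) ≡ a + (2 + k)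
  shift a = sym (trans (+-suc a (suc k)) (cong suc (+-suc a k)))

module Chain (ν : DVar (suc n) → Fin N) (ν-injective : Injective _≡_ _≡_ ν)
             (s : Fin (suc n) → Bool) where
  open Embedded ν ν-injective using (ext; ext-ν; labels)

  label₁ mid label₂ : Fin (suc n) → DVar (suc n)
  label₁ i = if s i then xa i else xd i
  mid    i = if s i then xb i else xe i
  label₂ i = if s i then xc i else xf i

  edge₁ : ∀ i → Edge (x (inject₁ i)) (label₁ i) (mid i)
  edge₁ i with s i
  ... | true  = edgeᵃ i
  ... | false = edgeᵈ i

  edge₂ : ∀ i → Edge (mid i) (label₂ i) (x (suc i))
  edge₂ i with s i
  ... | true  = edgeᶜ i
  ... | false = edgeᶠ i

  blockLiterals : Fin (suc n) → List (Literal N)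
  blockLiterals i = (ν (label₁ i) , false) ∷ (ν (label₂ i) , false) ∷ []

  assumptions : List (Literal N)
  assumptions = concatMap blockLiterals (allFin (suc n))

  All-assumptions : ∀ {P : Literal N → Set} → (∀ i → P (ν (label₁ i) , false)) →
                    (∀ i → P (ν (label₂ i) , false)) → All P assumptions
  All-assumptions p₁ p₂ = All-concatMap-allFin blockLiterals λ i → p₁ i ∷ p₂ i ∷ []

  assumptions∈lits : All (_∈lits D (suc n) ν) assumptions
  assumptions∈lits = All-assumptions (λ i → label∈ (edge₁ i)) (λ i → label∈ (edge₂ i))
    where
    label∈ : ∀ {u v w} → Edge u v w → ν v ∈ varsᶠ (D (suc n) ν)
    label∈ {u} {v} {w} e with edge-distinct e
    ... | v≢u , v≢w , _ = ∈varsᶠ⁺ (edge∈D ν e) (lookup⇒[]= _ _ (trans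
      (occ-∷-≢ (ν v ∷ ν w ∷ []) true (v≢u ∘ ν-injective))
      (occ-head {u = ν v} (ν w ∷ []) true ((v≢w ∘ ν-injective) ∷ []))))

  assumptions⊆labels : All (λ l → ext (labels s) (proj₁ l) ≡ true) assumptions
  assumptions⊆labels = All-assumptions
    (λ i → trans (ext-ν (labels s) (label₁ i)) (label₁∈ i))
    (λ i → trans (ext-ν (labels s) (label₂ i)) (label₂∈ i))
    where
    label₁∈ : ∀ i → labels s (label₁ i) ≡ true
    label₁∈ i with s i in eq
    ... | true  = eq
    ... | false = cong not eq
    label₂∈ : ∀ i → labels s (label₂ i) ≡ true
    label₂∈ i with s i in eq
    ... | true  = eq
    ... | false = cong not eq

  assumed : Formula N
  assumed = D (suc n) ν ++ map lit assumptions

  -- What an edge clause says about its ends once its label is set to ⊥; its parity ⊤ is thereby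
  -- unchanged.
  _~_ : DVar (suc n) → DVar (suc n) → XorClause N
  u ~ w = ν u ∷ ν w ∷ [] ≐ true

  blockEquivalences : Fin (suc n) → Formula N
  blockEquivalences i = (x (inject₁ i) ~ mid i) ∷ (mid i ~ x (suc i)) ∷ []

  equivalences : Formula N
  equivalences = concatMap blockEquivalences (allFin (suc n))

  equivalences-inferred : All (λ C → ∀ {π} → assumed ⊆ π → EC π C) equivalences
  equivalences-inferred = All-concatMap-allFin blockEquivalences λ i →
      inferred (edge₁ i) (literal∈ i (here refl)) ∷
      inferred (edge₂ i) (literal∈ i (there (here refl))) ∷ []
    where
    literal∈ : ∀ i {l} → l ∈ˡ blockLiterals i → lit l ∈ˡ assumed
    literal∈ i l∈ = ∈-++⁺ʳ (D (suc n) ν) (∈-map⁺ lit (∈-concatMap-allFin blockLiterals i l∈))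
    inferred : ∀ {u v w} → Edge u v w → lit (ν v , false) ∈ˡ assumed →
               ∀ {π} → assumed ⊆ π → EC π (u ~ w)
    inferred {u} {v} {w} e l∈ {π} ⊆π with edge-distinct e
    ... | v≢u , v≢w , u≢w =
      unit₃ (v≢u ∘ ν-injective) (v≢w ∘ ν-injective) (u≢w ∘ ν-injective) (⊆π l∈)
        (subst (_∈ˡ π) (≐-swap (ν u) (ν v) (ν w ∷ []) true) (⊆π (∈-++⁺ˡ (edge∈D ν e))))

  path : Fin (suc (suc n * 2)) → DVar (suc n)
  path = interleave (suc n) x mid

  -- xᵢ,b and xᵢ,e may share a position since a path visits only one of them; the default 0 concerns
  -- variables on no path. The summand 0 is the initial offset of `interleave-position`.
  position : DVar (suc n) → ℕ
  position (x i)  = toℕ i * 2 + 0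
  position (xb i) = suc (toℕ i * 2 + 0)
  position (xe i) = suc (toℕ i * 2 + 0)
  position _      = 0

  -- `position` recovers the index from the vertex.
  path-injective : Injective _≡_ _≡_ path
  path-injective {i} {j} eq = toℕ-injective (+-cancelʳ-≡ 0 (toℕ i) (toℕ j)
    (trans (sym (position-path i)) (trans (cong position eq) (position-path j))))
    where
    position-mid : ∀ i → position (mid i) ≡ suc (toℕ i * 2 + 0)
    position-mid i with s i
    ... | true  = refl
    ... | false = refl
    position-path : ∀ j → position (path j) ≡ toℕ j + 0
    position-path = interleave-position position 0 (suc n) x mid (λ _ → refl) position-mid

  -- The binary clauses link x₁ to xₙ₊₁ along the path, and `chain` combines them with the closing
  -- clause. The sign `b` is left open, as only the variable matters later.
  y-EC-derivable : ∃ λ b → Derivable EC assumed (lit (ν y , b))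
  y-EC-derivable = _ , _ ,
    infer (chain (ν ∘ path) (λ _ → true) (path-injective ∘ ν-injective)
            (λ eq → case ν-injective eq of λ ())
            (λ eq → case trans (ν-injective eq) (interleave-last (suc n) x mid) of λ ())
            (interleave-step (λ u w → (u ~ w) ∈ˡ equivalences ++ assumed) (suc n) x mid
              (λ i → step∈ i (here refl)) (λ i → step∈ i (there (here refl))))
            (∈-++⁺ʳ equivalences (∈-++⁺ˡ (subst (λ u → edgeClause ν (x zero) u y ∈ˡ D (suc n) ν)
              (sym (interleave-last (suc n) x mid)) (edge∈D ν closing)))))
          (infer-all equivalences-inferred) ,
    here refl
    where
    step∈ : ∀ i {C} → C ∈ˡ blockEquivalences i → C ∈ˡ equivalences ++ assumed
    step∈ i C∈ = ∈-++⁺ˡ (∈-concatMap-allFin blockEquivalences i C∈)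

-- From a simulation formula to one clause per path

module Simulation (ν : DVar (suc n) → Fin N) (ν-injective : Injective _≡_ _≡_ ν)
                  {ψ : Formula N} (sim : ECSimulation (D (suc n) ν) ψ)
                  (vars-ψ : varsᶠ ψ ≡ varsᶠ (D (suc n) ν)) where
  open Embedded ν ν-injective
  open ECSimulation sim

  ψ-vars⊆D : ∀ {E z} → E ∈ˡ ψ → z ∈ vars E → z ∈ varsᶠ (D (suc n) ν)
  ψ-vars⊆D {z = z} E∈ψ z∈E = subst (z ∈_) vars-ψ (∈varsᶠ⁺ E∈ψ z∈E)

  -- A solution of D(n) agrees on vars(D(n)) with a solution of D(n) ∧ ψ, and the clauses of ψ have
  -- no variables beyond those.
  all-Entailed : ∀ {E} → E ∈ˡ D (suc n) ν ++ ψ → Entailed E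
  all-Entailed {E} E∈ τ τ⊨D with ∈-++⁻ (D (suc n) ν) E∈
  ... | inj₁ E∈D = All.lookup τ⊨D E∈D
  ... | inj₂ E∈ψ =
    let σ , σ⊨ , σ≡τ = Equivalence.to (projection τ) τ⊨D
    in ⊨ᶜ-cong E (λ z∈E → σ≡τ (ψ-vars⊆D E∈ψ z∈E)) (All.lookup σ⊨ E∈)

  all-InImage : ∀ {E} → E ∈ˡ D (suc n) ν ++ ψ → InImage E
  all-InImage {E} E∈ {z} eq with ∈-++⁻ (D (suc n) ν) E∈
  ... | inj₁ E∈D = All.lookup D-InImage E∈D eq
  ... | inj₂ E∈ψ =
    let C , C∈D , z∈C = ∈varsᶠ⁻ (D (suc n) ν) (ψ-vars⊆D E∈ψ (lookup⇒[]= z _ eq))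
    in All.lookup D-InImage C∈D ([]=⇒lookup z∈C)

  -- Every edge, `closing` included, has some xⱼ as an end.
  D-contains-x : All (λ C → ∃ λ j → occ C (ν (x j)) ≡ true) (D (suc n) ν)
  D-contains-x = All-D ν contains
    where
    first : ∀ {u v w} → Edge u v w → occ (edgeClause ν u v w) (ν u) ≡ true
    first {u} {v} {w} e with edge-distinct e
    ... | v≢u , _ , u≢w = occ-head (ν v ∷ ν w ∷ []) true
      ((v≢u ∘ sym ∘ ν-injective) ∷ (u≢w ∘ ν-injective) ∷ [])
    last : ∀ {u v w} → Edge u v w → occ (edgeClause ν u v w) (ν w) ≡ true
    last {u} {v} {w} e with edge-distinct e
    ... | _ , v≢w , u≢w = trans (occ-∷-≢ (ν v ∷ ν w ∷ []) true (u≢w ∘ sym ∘ ν-injective))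
      (trans (occ-∷-≢ (ν w ∷ []) true (v≢w ∘ sym ∘ ν-injective)) (occ-head {u = ν w} [] true []))
    contains : ∀ {u v w} → Edge u v w → ∃ λ j → occ (edgeClause ν u v w) (ν (x j)) ≡ true
    contains closing   = zero , first closing
    contains (edgeᵃ i) = inject₁ i , first (edgeᵃ i)
    contains (edgeᶜ i) = suc i , last (edgeᶜ i)
    contains (edgeᵈ i) = inject₁ i , first (edgeᵈ i)
    contains (edgeᶠ i) = suc i , last (edgeᶠ i)

  -- The simulation turns the EC-derivation along the path into a UP-derivation of a literal of y,
  -- which is not a path label.
  soleOutsideClause : ∀ s → ∃ λ E → E ∈ˡ D (suc n) ν ++ ψ × SoleOutside (ext (labels s)) E
  soleOutsideClause s = drop-literals assumptions⊆labels
    (UP-soleOutside (ext (labels s)) (ext-ν (labels s) y)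
      (simulation assumptions assumptions∈lits _ (proj₂ y-EC-derivable)))
    where open Chain ν ν-injective s

  pathClause : ∀ s → ∃ λ E → E ∈ˡ ψ × (∀ i → occ E (ν (xa i)) ≡ s i)
  pathClause s with soleOutsideClause s
  ... | E , E∈ , sole = E , E∈ψ , occ-xa s entailed sole νy≡pivot
    where
    entailed : Entailed E
    entailed = all-Entailed E∈
    νy≡pivot = pivot≡y s entailed sole (all-InImage E∈)
    E∈ψ : E ∈ˡ ψ
    E∈ψ with ∈-++⁻ (D (suc n) ν) E∈
    ... | inj₂ E∈ψ = E∈ψ
    -- A clause of D(n) would contain some xⱼ, which is neither a path label nor the pivot.
    ... | inj₁ E∈D =
      let j , eq = All.lookup D-contains-x E∈D in
      contradiction (trans (sym eq) (occ-outside s entailed sole νy≡pivot {x j} refl λ ())) λ ()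

-- The 2ⁿ paths

funToFin-cong : ∀ {k} {f g : Fin m → Fin k} → (∀ i → f i ≡ g i) → funToFin f ≡ funToFin g
funToFin-cong {m = zero}  f≗g = refl
funToFin-cong {m = suc m} f≗g = cong₂ combine (f≗g zero) (funToFin-cong (f≗g ∘ suc))

-- The paths are numbered in binary: each digit chooses the branch in one diamond.
bits : Fin (2 ^ n) → Fin n → Bool
bits {n} k i = Inverse.to 2↔Bool (finToFun {2} {n} k i)

bits-injective : ∀ {k l : Fin (2 ^ n)} → (∀ i → bits {n} k i ≡ bits {n} l i) → k ≡ l
bits-injective {n} {k} {l} eq = begin
  k                              ≡⟨ funToFin-finToFin {n} k ⟨
  funToFin (finToFun {2} {n} k)  ≡⟨ funToFin-cong (λ i → Injection.injective (Inverse⇒Injection 2↔Bool) (eq i)) ⟩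
  funToFin (finToFun {2} {n} l)  ≡⟨ funToFin-finToFin {n} l ⟩
  l                              ∎
  where open ≡-Reasoning

lemma2 : ∀ (n : ℕ) → 1 ≤ n → ∀ (N : ℕ) (ν : DVar n → Fin N) → Injective _≡_ _≡_ ν →
    ∀ (ψ : Formula N) → ECSimulation (D n ν) ψ → varsᶠ ψ ≡ varsᶠ (D n ν) →
    2 ^ n ≤ length (deduplicate _≟ᶜ_ ψ)
-- A path is sent to the position of its clause in the deduplicated ψ. Equal positions mean equal
-- clauses, whose values at the xᵢ,a give back the path.
lemma2 (suc n) (s≤s _) N ν ν-injective ψ sim vars-ψ = injective⇒≤ {f = index ∘ clause∈} λ {k} {l} eq →
  bits-injective {suc n} λ i → begin
    bits {suc n} k i             ≡⟨ proj₂ (proj₂ (found k)) i ⟨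
    occ (clause k) (ν (xa i))    ≡⟨ cong (λ C → occ C (ν (xa i))) (index-injective (setoid _) (clause∈ k) (clause∈ l) eq) ⟩
    occ (clause l) (ν (xa i))    ≡⟨ proj₂ (proj₂ (found l)) i ⟩
    bits {suc n} l i             ∎
  where
  open ≡-Reasoning
  open Simulation ν ν-injective sim vars-ψ using (pathClause)
  found : ∀ k → ∃ λ E → E ∈ˡ ψ × (∀ i → occ E (ν (xa i)) ≡ bits {suc n} k i)
  found k = pathClause (bits {suc n} k)
  clause : Fin (2 ^ suc n) → XorClause N
  clause k = proj₁ (found k)
  clause∈ : ∀ k → clause k ∈ˡ deduplicate _≟ᶜ_ ψ
  clause∈ k = ∈-deduplicate⁺ _≟ᶜ_ (proj₁ (proj₂ (found k)))
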